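{- Let $N$ be an odd positive integer with $\sigma^*(\sigma^*(N))=2N$ and $N\neq 9,165$, and write $\sigma^*(N)=2^{f_1}q^{f_2}$ with $q$ an odd prime and $f_1,f_2\ge1$. Then $q\notin\{7,11,13\}$.
   Context: $\sigma^*(n)$ is the sum of the unitary divisors of $n$, i.e. divisors $d$ of $n$ with $\gcd(d,n/d)=1$. For odd $N$ with $\sigma^*(\sigma^*(N))=2N$, $\sigma^*(N)$ is always of the form $2^{f_1}q^{f_2}$ with $q$ an odd prime. -}

module Defs where

open import Data.Nat using (ℕ; zero; suc; _+_; _*_; _/_)
open import Data.Nat.Divisibility using (_∣?_)
open import Data.Nat.GCD using (gcd)
open import Data.Nat.Properties using (_≟_)
open import Data.Nat.ListAction using (sum)
open import Data.List using (List; filter; map; upTo)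
open import Relation.Nullary.Decidable using (_×-dec_)

-- Candidate divisors 1, 2, …, n (each written as suc k, hence nonzero).
-- d = suc k is a unitary divisor of n iff d ∣ n and gcd d (n / d) ≡ 1.
unitaryDivisors : ℕ → List ℕ
unitaryDivisors n =
  map suc (filter (λ k → (suc k ∣? n) ×-dec (gcd (suc k) (n / suc k) ≟ 1)) (upTo n))

σ* : ℕ → ℕ
σ* n = sum (unitaryDivisors n)

{-# OPTIONS --safe #-}
-- Write N = ∏ Pᵢ with coprime prime powers Pᵢ. Each Bᵢ = Pᵢ + 1 divides σ* N, so Bᵢ = 2ˣ q^y with
-- x ≥ 1, and with F = 2^f₁, Q = q^f₂ the equation σ*(σ* N) = 2N reads
-- ∏ (1 - 1/Bᵢ) = (1 + 1/F)(1 + 1/Q)/2. The Bᵢ are distinct, so the left side is at least the product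
-- over all admissible B. If y = 0 then B = 4 or x is odd; when f₂ is even, odd x is impossible, since a
-- prime p ≡ 3 (mod 4) divides no s² + 1, and p ∣ 2^f₁ + 1 contradicts p ∣ 2ˣ - 1. The resulting lower
-- bounds exceed the right side, except when q = 13, f₂ = 1, f₁ = 3, which would force N = 63.
module Submission where

open import Defs
open import Data.Nat hiding (parity)
open import Data.Nat.Properties
open import Data.Nat.Divisibility
open import Data.Nat.DivMod
open import Data.Nat.Primality
open import Data.Nat.Coprimality as Coprime using (Coprime; coprime-divisor)
open import Data.Nat.GCD using (gcd)
open import Data.Nat.Induction using (<-rec)
open import Data.Nat.ListAction using (sum; product)
open import Data.Nat.ListAction.Properties using (sum-++; sum-↭; product-++; product-↭; product≢0; ∈⇒∣product)
open import Data.Nat.Tactic.RingSolver using (solve-∀)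
open import Data.Bool.Base using (T)
open import Data.List using (List; []; _∷_; [_]; _++_; map; upTo)
open import Data.List.Properties using (map-++; map-∘; map-id)
open import Data.List.Membership.Propositional using (_∈_)
open import Data.List.Membership.Propositional.Properties
open import Data.List.Relation.Binary.Permutation.Propositional using (_↭_; ↭-refl; ↭-trans; prep)
open import Data.List.Relation.Binary.Permutation.Propositional.Properties using (shift; ∈-resp-↭; map⁺)
open import Data.List.Relation.Unary.Any using (here; there)
open import Data.List.Relation.Unary.All as All using (All; []; _∷_)
import Data.List.Relation.Unary.All.Properties as All
open import Data.List.Relation.Unary.AllPairs using ([]; _∷_)
open import Data.List.Relation.Unary.Unique.Propositional using (Unique)
import Data.List.Relation.Unary.Unique.Propositional.Properties as Unique
open import Data.Product using (∃₂; ∃-syntax; _×_; _,_; proj₁; proj₂)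
open import Data.Sum using (_⊎_; inj₁; inj₂; [_,_]′)
open import Data.Empty using (⊥-elim)
open import Function using (_∘_; id)
open import Relation.Nullary using (¬_; yes; no; contradiction)
open import Relation.Nullary.Decidable using (_×-dec_; from-yes)
open import Relation.Binary.PropositionalEquality hiding ([_])

-- Duplicate-free lists contained in other lists

-- Naming the leftover `zs` lets a sum or product over `ys` be split into the part over `xs` and an
-- excess. In the induction `x` is moved to the front of `ys` and removed; the other members of `xs`
-- differ from `x`, so they survive.
unique-⊆⇒↭-++ : ∀ {A : Set} {xs ys : List A} → Unique xs → (∀ {x} → x ∈ xs → x ∈ ys) →
                ∃[ zs ] ys ↭ xs ++ zs
unique-⊆⇒↭-++ {ys = ys} [] _ = ys , ↭-refl
unique-⊆⇒↭-++ {xs = x ∷ xs} (x≢xs ∷ uxs) xs⊆ys with ∈-∃++ (xs⊆ys (here refl))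
... | as , bs , refl = proj₁ ih , ↭-trans (shift x as bs) (prep x (proj₂ ih))
  where
  drop-x : ∀ {y} → y ∈ xs → y ∈ x ∷ as ++ bs → y ∈ as ++ bs
  drop-x y∈xs (here refl) = contradiction refl (All.lookup x≢xs y∈xs)
  drop-x _ (there y∈) = y∈
  ih = unique-⊆⇒↭-++ uxs λ y∈xs → drop-x y∈xs (∈-resp-↭ (shift x as bs) (xs⊆ys (there y∈xs)))

sum-mono-⊆ : ∀ {xs ys} → Unique xs → (∀ {x} → x ∈ xs → x ∈ ys) → sum xs ≤ sum ys
sum-mono-⊆ {xs} {ys} uxs xs⊆ys with unique-⊆⇒↭-++ uxs xs⊆ys
... | zs , ys↭ = begin
  sum xs           ≤⟨ m≤m+n (sum xs) (sum zs) ⟩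
  sum xs + sum zs  ≡⟨ sum-++ xs zs ⟨
  sum (xs ++ zs)   ≡⟨ sum-↭ ys↭ ⟨
  sum ys           ∎
  where open ≤-Reasoning

sum-map-* : ∀ k xs → sum (map (k *_) xs) ≡ k * sum xs
sum-map-* k [] = sym (*-zeroʳ k)
sum-map-* k (x ∷ xs) = trans (cong (k * x +_) (sum-map-* k xs)) (sym (*-distribˡ-+ k x (sum xs)))

-- Unitary divisors and the multiplicativity of `σ*`

-- The explicit cofactor replaces the quotient `n / d` and makes the roles of `d` and `e`
-- interchangeable.
UnitaryDivisor : ℕ → ℕ → Set
UnitaryDivisor n d = ∃[ e ] d * e ≡ n × Coprime d e

module _ {n : ℕ} .{{_ : NonZero n}} where

  ∈-unitaryDivisors⁺ : ∀ {d} → UnitaryDivisor n d → d ∈ unitaryDivisors n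
  ∈-unitaryDivisors⁺ {zero} (e , refl , c) = ⊥-elim (≢-nonZero⁻¹ n refl)
  ∈-unitaryDivisors⁺ {suc k} (e , de≡n , c) =
    ∈-map⁺ suc (∈-filter⁺ (λ k → (suc k ∣? n) ×-dec (gcd (suc k) (n / suc k) ≟ 1)) (∈-upTo⁺ (∣⇒≤ d∣n)) (d∣n , gcd≡1))
    where
    d∣n : suc k ∣ n
    d∣n = divides e (trans (sym de≡n) (*-comm (suc k) e))
    n/d≡e : n / suc k ≡ e
    n/d≡e = trans (cong (_/ suc k) (trans (sym de≡n) (*-comm (suc k) e))) (m*n/n≡m e (suc k))
    gcd≡1 : gcd (suc k) (n / suc k) ≡ 1
    gcd≡1 = trans (cong (gcd (suc k)) n/d≡e) (Coprime.coprime⇒gcd≡1 c)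

  ∈-unitaryDivisors⁻ : ∀ {d} → d ∈ unitaryDivisors n → UnitaryDivisor n d
  ∈-unitaryDivisors⁻ d∈ with ∈-map⁻ suc d∈
  ... | k , k∈ , refl with ∈-filter⁻ (λ k → (suc k ∣? n) ×-dec (gcd (suc k) (n / suc k) ≟ 1)) {xs = upTo n} k∈
  ... | _ , divides e n≡e*d , gcd≡1 = e , trans (*-comm (suc k) e) (sym n≡e*d) ,
    Coprime.gcd≡1⇒coprime (trans (cong (gcd (suc k)) (sym (trans (cong (_/ suc k) n≡e*d) (m*n/n≡m e (suc k))))) gcd≡1)

unitaryDivisors-unique : ∀ n → Unique (unitaryDivisors n)
unitaryDivisors-unique n = Unique.map⁺ suc-injective (Unique.filter⁺ _ (Unique.upTo⁺ n))

coprime-*ʳ : ∀ {d m n} → Coprime d m → Coprime d n → Coprime d (m * n)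
coprime-*ʳ {d} {m} {n} c c′ {i} (i∣d , i∣mn) =
  c′ (i∣d , coprime-divisor (λ (j∣i , j∣m) → c (∣-trans j∣i i∣d , j∣m)) i∣mn)

prime∤⇒coprime : ∀ {p d} → Prime p → ¬ p ∣ d → Coprime d p
prime∤⇒coprime p-prime p∤d (i∣d , i∣p) with prime⇒irreducible p-prime i∣p
... | inj₁ i≡1 = i≡1
... | inj₂ refl = contradiction i∣d p∤d

coprime-^ʳ : ∀ {d p} a → Coprime d p → Coprime d (p ^ a)
coprime-^ʳ zero c (_ , i∣1) = ∣1⇒≡1 i∣1
coprime-^ʳ (suc a) c = coprime-*ʳ c (coprime-^ʳ a c)

prime^-nonZero : ∀ {p} → Prime p → ∀ a → NonZero (p ^ a)
prime^-nonZero {p} p-prime a = m^n≢0 p a where instance _ = prime⇒nonZero p-prime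

module _ {p : ℕ} (p-prime : Prime p) {m : ℕ} .{{m≢0 : NonZero m}} (p∤m : ¬ p ∣ m) (a : ℕ) where

  private
    P = p ^ suc a
    instance
      P≢0 : NonZero P
      P≢0 = prime^-nonZero p-prime (suc a)
      Pm≢0 : NonZero (P * m)
      Pm≢0 = m*n≢0 P m

  private
    coprimeP : ∀ {d} → ¬ p ∣ d → Coprime d P
    coprimeP p∤d = coprime-^ʳ (suc a) (prime∤⇒coprime p-prime p∤d)

    p∤divisor : ∀ {d} → d ∣ m → ¬ p ∣ d
    p∤divisor d∣m p∣d = p∤m (∣-trans p∣d d∣m)

    -- Since `p` does not divide `d`, all of `P` must sit in the cofactor. Exchanging `d` and `e`
    -- covers the case where `p` divides `d`.
    split : ∀ {d e} → d * e ≡ P * m → Coprime d e → ¬ p ∣ d → ∃[ e′ ] d * e′ ≡ m × e ≡ P * e′ × Coprime d e′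
    split {d} {e} de≡Pm c p∤d with coprime-divisor {d} {P} {m} (coprimeP p∤d) (divides e (trans (sym de≡Pm) (*-comm d e)))
    ... | divides e′ m≡e′d = e′ , trans (*-comm d e′) (sym m≡e′d) , e≡Pe′ , λ (i∣d , i∣e′) → c (i∣d , subst (_ ∣_) (sym e≡Pe′) (∣n⇒∣m*n P i∣e′))
      where
      instance
        d≢0 : NonZero d
        d≢0 = ≢-nonZero λ { refl → p∤d (p ∣0) }
      e≡Pe′ : e ≡ P * e′
      e≡Pe′ = *-cancelˡ-≡ e (P * e′) d (trans de≡Pm (trans (cong (P *_) m≡e′d) (lemma P e′ d)))
        where
        lemma : ∀ x y z → x * (y * z) ≡ z * (x * y)
        lemma = solve-∀

    -- A unitary divisor of `P * m` contains either nothing of `P` or all of it, and these are the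
    -- two halves of the list.
    glued = unitaryDivisors m ++ map (P *_) (unitaryDivisors m)

    glued-unique : Unique glued
    glued-unique = Unique.++⁺ (unitaryDivisors-unique m)
      (Unique.map⁺ (λ {x} {y} → *-cancelˡ-≡ x y P) (unitaryDivisors-unique m))
      λ (d∈ , Pd′∈) → disjoint d∈ (∈-map⁻ (P *_) Pd′∈)
      where
      disjoint : ∀ {d} → d ∈ unitaryDivisors m → ¬ (∃[ d′ ] d′ ∈ unitaryDivisors m × d ≡ P * d′)
      disjoint d∈ (d′ , _ , refl) with ∈-unitaryDivisors⁻ d∈
      ... | e , de≡m , _ = p∤m (∣-trans (m∣m*n (p ^ a)) (∣-trans (m∣m*n d′) (∣-trans (m∣m*n e) (∣-reflexive de≡m))))

    glued⇒unitary : ∀ {d} → d ∈ glued → d ∈ unitaryDivisors (P * m)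
    glued⇒unitary {d} d∈ with ∈-++⁻ (unitaryDivisors m) d∈
    ... | inj₁ d∈m with ∈-unitaryDivisors⁻ d∈m
    ... | e , de≡m , c = ∈-unitaryDivisors⁺ (P * e , trans (lemma d P e) (cong (P *_) de≡m) ,
            coprime-*ʳ (coprimeP (p∤divisor (subst (_ ∣_) de≡m (m∣m*n e)))) c)
      where
      lemma : ∀ x y z → x * (y * z) ≡ y * (x * z)
      lemma = solve-∀
    glued⇒unitary {_} d∈ | inj₂ Pd∈ with ∈-map⁻ (P *_) Pd∈
    ... | d , d∈m , refl with ∈-unitaryDivisors⁻ d∈m
    ... | e , de≡m , c = ∈-unitaryDivisors⁺ (e , trans (*-assoc P d e) (cong (P *_) de≡m) ,
            Coprime.sym (coprime-*ʳ (coprimeP (p∤divisor (subst (_ ∣_) de≡m (n∣m*n d)))) (Coprime.sym c)))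

    unitary⇒glued : ∀ {d} → UnitaryDivisor (P * m) d → d ∈ glued
    unitary⇒glued {d} (e , de≡Pm , c) with p ∣? d
    ... | no p∤d = let e′ , de′≡m , _ , c′ = split de≡Pm c p∤d in
            ∈-++⁺ˡ (∈-unitaryDivisors⁺ (e′ , de′≡m , c′))
    ... | yes p∣d = let d′ , ed′≡m , d≡Pd′ , c′ = split (trans (*-comm e d) de≡Pm) (Coprime.sym c) p∤e in
            subst (_∈ glued) (sym d≡Pd′) (∈-++⁺ʳ (unitaryDivisors m)
              (∈-map⁺ (P *_) (∈-unitaryDivisors⁺ (e , trans (*-comm d′ e) ed′≡m , Coprime.sym c′))))
      where
      p∤e : ¬ p ∣ e
      p∤e p∣e = ¬prime[1] (subst Prime (c (p∣d , p∣e)) p-prime)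

  σ*-prime^-* : σ* (P * m) ≡ suc P * σ* m
  σ*-prime^-* = begin
    -- Both lists are duplicate-free, so inclusion in each direction bounds each sum by the other.
    σ* (P * m)                                   ≡⟨ ≤-antisym (sum-mono-⊆ (unitaryDivisors-unique (P * m)) (unitary⇒glued ∘ ∈-unitaryDivisors⁻ {P * m}))
                                                              (sum-mono-⊆ glued-unique glued⇒unitary) ⟩
    sum glued                                    ≡⟨ sum-++ (unitaryDivisors m) _ ⟩
    σ* m + sum (map (P *_) (unitaryDivisors m))  ≡⟨ cong (σ* m +_) (sum-map-* P (unitaryDivisors m)) ⟩
    suc P * σ* m                                 ∎
    where open ≡-Reasoning

σ*-prime^ : ∀ {p} → Prime p → ∀ a → σ* (p ^ suc a) ≡ suc (p ^ suc a)
σ*-prime^ {p} p-prime a = begin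
  σ* (p ^ suc a)       ≡⟨ cong σ* (*-identityʳ (p ^ suc a)) ⟨
  σ* (p ^ suc a * 1)   ≡⟨ σ*-prime^-* p-prime (λ p∣1 → ¬prime[1] (subst Prime (∣1⇒≡1 p∣1) p-prime)) a ⟩
  suc (p ^ suc a) * 1  ≡⟨ *-identityʳ _ ⟩
  suc (p ^ suc a)      ∎
  where open ≡-Reasoning

-- Decomposition into coprime prime powers

record PrimePower (P : ℕ) : Set where
  constructor primePower
  field
    {base}   : ℕ
    isPrime  : Prime base
    exponent : ℕ
    equation : P ≡ base ^ suc exponent

-- Coprimality enters through `product≡σ*`; `distinct` is what allows the numbers P + 1 to be
-- compared with a list of all admissible values.
record Components (n : ℕ) : Set where
  field
    list       : List ℕ
    powers     : All PrimePower list
    distinct   : Unique list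
    product≡n  : product list ≡ n
    product≡σ* : product (map suc list) ≡ σ* n

prime-divisor : ∀ n → 1 < n → ∃[ p ] Prime p × p ∣ n
prime-divisor = <-rec _ λ n rec 1<n → go n rec 1<n
  where
  go : ∀ n → (∀ {m} → m < n → 1 < m → ∃[ p ] Prime p × p ∣ m) → 1 < n → ∃[ p ] Prime p × p ∣ n
  go n rec 1<n with prime? n
  ... | yes n-prime = n , n-prime , ∣-refl
  ... | no n-composite with ¬prime⇒composite {{n>1⇒nonTrivial 1<n}} n-composite
  ... | hasNonTrivialDivisor {d} d<n d∣n with rec d<n (nonTrivial⇒n>1 d)
  ... | p , p-prime , p∣d = p , p-prime , ∣-trans p∣d d∣n

extract-power : ∀ {p} → 1 < p → ∀ n → .{{NonZero n}} → ∃₂ λ a m → n ≡ p ^ a * m × ¬ p ∣ m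
extract-power {p} 1<p = <-rec _ go
  where
  go : ∀ n → (∀ {m} → m < n → .{{NonZero m}} → ∃₂ λ a k → m ≡ p ^ a * k × ¬ p ∣ k) →
       .{{NonZero n}} → ∃₂ λ a k → n ≡ p ^ a * k × ¬ p ∣ k
  go n rec with p ∣? n
  ... | no p∤n = 0 , n , sym (*-identityˡ n) , p∤n
  ... | yes p∣n with rec (quotient-< p∣n {{n>1⇒nonTrivial 1<p}}) {{quotient≢0 p∣n}}
  ... | a , k , q≡ , p∤k = suc a , k , trans (m∣n⇒n≡m*quotient p∣n) (trans (cong (p *_) q≡) (sym (*-assoc p (p ^ a) k))) , p∤k

prime>1 : ∀ {p} → Prime p → 1 < p
prime>1 {p} p-prime = nonTrivial⇒n>1 p {{prime⇒nonTrivial p-prime}}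

components : ∀ n → .{{NonZero n}} → Components n
components = <-rec _ go
  where
  go : ∀ n → (∀ {m} → m < n → .{{NonZero m}} → Components m) → .{{NonZero n}} → Components n
  go 1 rec = record { list = [] ; powers = [] ; distinct = [] ; product≡n = refl ; product≡σ* = refl }
  go n@(suc (suc _)) rec with prime-divisor n (s≤s (s≤s z≤n))
  ... | p , p-prime , p∣n with extract-power (prime>1 p-prime) n
  ... | zero , m , n≡m , p∤m = contradiction (subst (p ∣_) (trans n≡m (+-identityʳ m)) p∣n) p∤m
  ... | suc a , m , n≡Pm , p∤m = record
    { list = P ∷ list
    ; powers = primePower p-prime a refl ∷ powers
    -- A component of `m` equal to `P` would make `p` divide `m`.
    ; distinct = All.tabulate (λ Q∈ P≡Q → p∤m (∣-trans (m∣m*n (p ^ a))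
                    (subst (_∣ m) (sym P≡Q) (subst (_ ∣_) product≡n (∈⇒∣product Q∈))))) ∷ distinct
    ; product≡n = trans (cong (P *_) product≡n) (sym n≡Pm)
    ; product≡σ* = trans (cong (suc P *_) product≡σ*) (trans (sym (σ*-prime^-* p-prime p∤m a)) (cong σ* (sym n≡Pm)))
    }
    where
    P = p ^ suc a
    instance
      m≢0 : NonZero m
      m≢0 = ≢-nonZero λ { refl → p∤m (p ∣0) }
    1<P : 1 < P
    1<P = ≤-trans (prime>1 p-prime) (m≤m*n p (p ^ a) {{prime^-nonZero p-prime a}})
    m<n : m < n
    m<n = subst (m <_) (trans (*-comm m P) (sym n≡Pm)) (m<m*n m P 1<P)
    open Components (rec m<n)

-- Parity, and divisors of s² + 1 modulo 4

even-or-odd : ∀ n → ∃[ k ] (n ≡ 2 * k ⊎ n ≡ suc (2 * k))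
even-or-odd zero = 0 , inj₁ refl
even-or-odd (suc n) with even-or-odd n
... | k , inj₁ n≡2k = k , inj₂ (cong suc n≡2k)
... | k , inj₂ n≡1+2k = suc k , inj₁ (trans (cong suc n≡1+2k) (lemma k))
  where
  lemma : ∀ k → 2 + 2 * k ≡ 2 * suc k
  lemma = solve-∀

odd⇒2∣suc : ∀ {n} → ¬ 2 ∣ n → 2 ∣ suc n
odd⇒2∣suc {n} 2∤n with even-or-odd n
... | k , inj₁ refl = contradiction (m∣m*n k) 2∤n
... | k , inj₂ refl = divides (suc k) (lemma k)
  where
  lemma : ∀ k → suc (suc (2 * k)) ≡ suc k * 2
  lemma = solve-∀

-- The cofactor of an even s in s² + 1 ≡ 1 (mod 4) is again 3 mod 4, and it is smaller than n
-- once s < n.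
3mod4∤1+square : ∀ n → n % 4 ≡ 3 → ∀ s → ¬ n ∣ suc (s * s)
3mod4∤1+square = <-rec _ go
  where
  go : ∀ n → (∀ {m} → m < n → m % 4 ≡ 3 → ∀ s → ¬ m ∣ suc (s * s)) → n % 4 ≡ 3 → ∀ s → ¬ n ∣ suc (s * s)
  go zero rec () s
  go n@(suc n-1) rec n%4≡3 s n∣ = conclude (even-root (even-or-odd (s % n)))
    where
    r = s % n
    m = s / n

    -- Descent needs a root below `n`, so `s` is first replaced by its residue.
    n∣1+r² : n ∣ suc (r * r)
    n∣1+r² = ∣m+n∣m⇒∣n {n} {n * (m * (r + r) + m * n * m)} {suc (r * r)}
      (subst (n ∣_) (begin
        suc (s * s)                      ≡⟨ cong (λ s → suc (s * s)) (m≡m%n+[m/n]*n s n) ⟩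
        suc ((r + m * n) * (r + m * n))  ≡⟨ lemma r m n ⟩
        n * (m * (r + r) + m * n * m) + suc (r * r) ∎) n∣)
      (m∣m*n _)
      where
      open ≡-Reasoning
      lemma : ∀ r m n → suc ((r + m * n) * (r + m * n)) ≡ n * (m * (r + r) + m * n * m) + suc (r * r)
      lemma = solve-∀

    2∤n : ¬ 2 ∣ n
    2∤n 2∣n = case-odd (trans (m∣n⇒o%n%m≡o%m 2 4 n (divides 2 refl)) (n∣m⇒m%n≡0 n 2 2∣n))
      where
      case-odd : ¬ n % 4 % 2 ≡ 0
      case-odd rewrite n%4≡3 = λ ()

    -- If `r` is odd, then n - r is even because `n` is odd, and it is a root as well, being
    -- congruent to -r.
    even-root : ∃[ k ] (r ≡ 2 * k ⊎ r ≡ suc (2 * k)) → ∃[ u ] 2 * u < n × n ∣ suc (2 * u * (2 * u))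
    even-root (u , inj₁ r≡2u) = u , subst (_< n) r≡2u (m%n<n s n) , subst (λ r → n ∣ suc (r * r)) r≡2u n∣1+r²
    even-root (k , inj₂ r≡1+2k) = flip (even-or-odd (n ∸ r))
      where
      r+t≡n : r + (n ∸ r) ≡ n
      r+t≡n = m+[n∸m]≡n (m%n≤n s n)
      t<n : n ∸ r < n
      t<n rewrite r≡1+2k = s≤s (m∸n≤m n-1 (2 * k))
      n∣1+t² : n ∣ suc ((n ∸ r) * (n ∸ r))
      n∣1+t² = reflect r (n ∸ r) r+t≡n n∣1+r²
        where
        lemma : ∀ r t → t * (r + t) + suc (r * r) ≡ r * (r + t) + suc (t * t)
        lemma = solve-∀
        reflect : ∀ r t → r + t ≡ n → n ∣ suc (r * r) → n ∣ suc (t * t)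
        reflect r t r+t≡n n∣1+r² = ∣m+n∣m⇒∣n (subst (n ∣_)
          (trans (cong (λ n → t * n + suc (r * r)) (sym r+t≡n)) (trans (lemma r t) (cong (λ n → r * n + suc (t * t)) r+t≡n)))
          (∣m∣n⇒∣m+n (n∣m*n t) n∣1+r²)) (n∣m*n r)
      flip : ∃[ k ] (n ∸ r ≡ 2 * k ⊎ n ∸ r ≡ suc (2 * k)) → ∃[ u ] 2 * u < n × n ∣ suc (2 * u * (2 * u))
      flip (u , inj₁ t≡2u) = u , subst (_< n) t≡2u t<n , subst (λ t → n ∣ suc (t * t)) t≡2u n∣1+t²
      flip (u , inj₂ t≡1+2u) = contradiction (divides (suc (k + u)) (trans (sym r+t≡n) (trans (cong₂ _+_ r≡1+2k t≡1+2u) (lemma k u)))) 2∤n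
        where
        lemma : ∀ k u → suc (2 * k) + suc (2 * u) ≡ suc (k + u) * 2
        lemma = solve-∀

    conclude : ¬ (∃[ u ] 2 * u < n × n ∣ suc (2 * u * (2 * u)))
    conclude (u , 2u<n , divides k 1+4u²≡kn) = rec k<n k%4≡3 (2 * u) (divides n (trans 1+4u²≡kn (*-comm k n)))
      where
      k%4≡3 : k % 4 ≡ 3
      -- The even root gives k n = 1 + 4u², so 3k leaves remainder 1 modulo 4.
      k%4≡3 = residue (k % 4) (m%n<n k 4) (begin
        (k % 4 * 3) % 4          ≡⟨ cong (λ x → (k % 4 * x) % 4) n%4≡3 ⟨
        (k % 4 * (n % 4)) % 4    ≡⟨ %-distribˡ-* k n 4 ⟨
        (k * n) % 4              ≡⟨ cong (_% 4) 1+4u²≡kn ⟨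
        suc (2 * u * (2 * u)) % 4 ≡⟨ cong (_% 4) (lemma u) ⟩
        (1 + u * u * 4) % 4      ≡⟨ [m+kn]%n≡m%n 1 (u * u) 4 ⟩
        1                        ∎)
        where
        open ≡-Reasoning
        lemma : ∀ u → suc (2 * u * (2 * u)) ≡ 1 + u * u * 4
        lemma = solve-∀
        residue : ∀ c → c < 4 → (c * 3) % 4 ≡ 1 → c ≡ 3
        residue 3 _ _ = refl
        residue (suc (suc (suc (suc c)))) (s≤s (s≤s (s≤s (s≤s ())))) _
      k<n : k < n
      -- From 2u ≤ n - 1 follows k n ≤ (n - 1)² + 1, which is less than n² as n > 1.
      k<n = *-cancelʳ-< n k n (begin-strict
        k * n                      ≡⟨ 1+4u²≡kn ⟨
        suc (2 * u * (2 * u))      ≤⟨ s≤s (*-mono-≤ (s≤s⁻¹ 2u<n) (s≤s⁻¹ 2u<n)) ⟩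
        suc (n-1 * n-1)            ≤⟨ s≤s (m≤n+m (n-1 * n-1) n-1) ⟩
        suc (n-1 + n-1 * n-1)      ≡⟨ cong suc (*-suc n-1 n-1) ⟨
        suc (n-1 * n)              <⟨ s≤s (m<n+m (n-1 * n) {n-1} n-1>0) ⟩
        n * n                      ∎)
        where
        open ≤-Reasoning
        n-1>0 : 0 < n-1
        n-1>0 = positive n-1 n%4≡3
          where
          positive : ∀ x → suc x % 4 ≡ 3 → 0 < x
          positive (suc x) _ = s≤s z≤n

-- Divisors of powers and of numbers next to powers

-- Modulo a + 1 the base is -1. The induction raises the exponent by two, through a²(1 + x) + (1 +
-- a) = (1 + a)a + (1 + a²x).
suc∣suc-odd^ : ∀ a k → suc a ∣ suc (a ^ suc (2 * k))
suc∣suc-odd^ a zero = ∣-reflexive (cong suc (sym (*-identityʳ a)))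
suc∣suc-odd^ a (suc k) rewrite +-suc k (k + 0) = ∣m+n∣m⇒∣n
  (subst (suc a ∣_) (lemma a (a ^ suc (2 * k))) (∣m∣n⇒∣m+n (∣n⇒∣m*n (a * a) (suc∣suc-odd^ a k)) ∣-refl))
  (m∣m*n a)
  where
  lemma : ∀ a x → a * a * suc x + suc a ≡ suc a * a + suc (a * (a * x))
  lemma = solve-∀

∣pred-^ : ∀ b n {m} → suc m ≡ suc b ^ n → b ∣ m
∣pred-^ b zero refl = b ∣0
∣pred-^ b (suc n) {m} eq with suc b ^ n in eq′ | ∣pred-^ b n {pred (suc b ^ n)} (suc-pred (suc b ^ n) {{m^n≢0 (suc b) n}})
... | zero | _ = contradiction eq′ (≢-nonZero⁻¹ (suc b ^ n) {{m^n≢0 (suc b) n}})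
... | suc x | b∣x = subst (b ∣_) (sym (suc-injective eq)) (∣m∣n⇒∣m+n b∣x (m∣m*n (suc x)))

prime∣^⇒∣ : ∀ {p m} → Prime p → ∀ n → p ∣ m ^ n → p ∣ m
prime∣^⇒∣ p-prime zero p∣1 = contradiction (subst Prime (∣1⇒≡1 p∣1) p-prime) ¬prime[1]
prime∣^⇒∣ {m = m} p-prime (suc n) p∣ = [ id , prime∣^⇒∣ p-prime n ]′ (euclidsLemma m (m ^ n) p-prime p∣)

prime∣prime⇒≡ : ∀ {p q} → Prime p → Prime q → p ∣ q → p ≡ q
prime∣prime⇒≡ p-prime q-prime p∣q with prime⇒irreducible q-prime p∣q
... | inj₁ refl = contradiction p-prime ¬prime[1]
... | inj₂ p≡q = p≡q

-- Factors `p` are cancelled against `d` while they divide it; otherwise `d` is coprime to `p` and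
-- the factor is dropped. Applied to 2 and then to q, this gives the shape 2ˣ q^y of each P + 1.
∣prime^*⇒ : ∀ {p d} → Prime p → ∀ n m → d ∣ p ^ n * m → ∃₂ λ k e → k ≤ n × d ≡ p ^ k * e × e ∣ m
∣prime^*⇒ {d = d} p-prime zero m d∣ = 0 , d , z≤n , sym (*-identityˡ d) , subst (d ∣_) (*-identityˡ m) d∣
∣prime^*⇒ {p} {d} p-prime (suc n) m d∣ with p ∣? d
... | yes (divides c refl) with ∣prime^*⇒ {d = c} p-prime n m (*-cancelˡ-∣ p {{prime⇒nonZero p-prime}} (subst₂ _∣_ (*-comm c p) (*-assoc p (p ^ n) m) d∣))
... | k , e , k≤n , refl , e∣m = suc k , e , s≤s k≤n , trans (*-comm (p ^ k * e) p) (sym (*-assoc p (p ^ k) e)) , e∣m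
∣prime^*⇒ {p} {d} p-prime (suc n) m d∣ | no p∤d
  with ∣prime^*⇒ {d = d} p-prime n m (coprime-divisor (prime∤⇒coprime p-prime p∤d) (subst (d ∣_) (*-assoc p (p ^ n) m) d∣))
... | k , e , k≤n , d≡ , e∣m = k , e , m≤n⇒m≤1+n k≤n , d≡ , e∣m

1mod4-^ : ∀ {p} → p % 4 ≡ 1 → ∀ n → p ^ n % 4 ≡ 1
1mod4-^ p%4≡1 zero = refl
1mod4-^ {p} p%4≡1 (suc n) = trans (%-distribˡ-* p (p ^ n) 4) (cong₂ (λ x y → (x * y) % 4) p%4≡1 (1mod4-^ p%4≡1 n))

-- Modulo 8 the powers of 3 alternate between 1 and 3.
8∤1+3^ : ∀ n → ¬ 8 ∣ suc (3 ^ n)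
8∤1+3^ 0 = >⇒∤ (s≤s (s≤s (s≤s z≤n)))
8∤1+3^ 1 = >⇒∤ (s≤s (s≤s (s≤s (s≤s (s≤s z≤n)))))
8∤1+3^ (suc (suc n)) 8∣ = 8∤1+3^ n (∣m+n∣m⇒∣n (subst (8 ∣_) (lemma (3 ^ n)) 8∣) (m∣m*n (3 ^ n)))
  where
  lemma : ∀ x → suc (3 * (3 * x)) ≡ 8 * x + suc x
  lemma = solve-∀

primePower>1 : ∀ {P} → PrimePower P → 1 < P
primePower>1 (primePower {p} p-prime a refl) = ≤-trans (prime>1 p-prime) (m≤m*n p (p ^ a) {{prime^-nonZero p-prime a}})

-- For even x ≥ 4, 3 divides 4^(x/2) - 1 = P, so `P` is a power of 3; but 8 divides P + 1, and it
-- never divides 1 + 3ⁿ.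
mersenne-exponent : ∀ {P} → PrimePower P → ∀ x → suc P ≡ 2 ^ x → x ≡ 2 ⊎ ∃[ k ] x ≡ 3 + 2 * k
mersenne-exponent P-pp 0 refl with () ← primePower>1 P-pp
mersenne-exponent P-pp 1 refl with s≤s () ← primePower>1 P-pp
mersenne-exponent P-pp 2 _ = inj₁ refl
mersenne-exponent P-pp@(primePower {p} p-prime a refl) (suc (suc (suc x))) eq with even-or-odd x
... | k , inj₁ refl = inj₂ (k , refl)
... | k , inj₂ refl = contradiction (divides (2 ^ suc (2 * k)) (trans (cong (suc ∘ (_^ suc a)) 3≡p) (trans eq (lemma (2 ^ suc (2 * k)))))) (8∤1+3^ (suc a))
  where
  lemma : ∀ x → 2 * (2 * (2 * x)) ≡ x * 8
  lemma = solve-∀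
  lemma′ : ∀ k → 3 + suc (2 * k) ≡ 2 * (2 + k)
  lemma′ = solve-∀
  prime[3] : Prime 3
  prime[3] = from-yes (prime? 3)
  3≡p : 3 ≡ p
  3≡p = prime∣prime⇒≡ prime[3] p-prime (prime∣^⇒∣ prime[3] (suc a)
    (∣pred-^ 3 (2 + k) (trans eq (trans (cong (2 ^_) (lemma′ k)) (sym (^-*-assoc 2 2 (2 + k)))))))

-- Lower bounds for products of factors 1 - 1/B

-- ∏ (1 - 1/B) ≥ a/b, the product being over the B in bs.
record Dense (a b : ℕ) (bs : List ℕ) : Set where
  constructor dense
  field bound : a * product bs ≤ b * product (map pred bs)

dense-++ : ∀ {a b c d} xs ys → Dense a b xs → Dense c d ys → Dense (a * c) (b * d) (xs ++ ys)
dense-++ {a} {b} {c} {d} xs ys (dense xs-bound) (dense ys-bound) = dense (begin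
  a * c * product (xs ++ ys)                                    ≡⟨ cong (a * c *_) (product-++ xs ys) ⟩
  a * c * (product xs * product ys)                             ≡⟨ lemma a c (product xs) (product ys) ⟩
  a * product xs * (c * product ys)                             ≤⟨ *-mono-≤ xs-bound ys-bound ⟩
  b * product (map pred xs) * (d * product (map pred ys))       ≡⟨ lemma b d _ _ ⟨
  b * d * (product (map pred xs) * product (map pred ys))       ≡⟨ cong (b * d *_) (product-++ (map pred xs) (map pred ys)) ⟨
  b * d * product (map pred xs ++ map pred ys)                  ≡⟨ cong (λ zs → b * d * product zs) (map-++ pred xs ys) ⟨
  b * d * product (map pred (xs ++ ys))                         ∎)
  where
  open ≤-Reasoning
  lemma : ∀ x y z w → x * y * (z * w) ≡ x * z * (y * w)
  lemma = solve-∀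

product-pred≤ : ∀ bs → product (map pred bs) ≤ product bs
product-pred≤ [] = ≤-refl
product-pred≤ (b ∷ bs) = *-mono-≤ (pred[n]≤n {b}) (product-pred≤ bs)

-- Every omitted factor 1 - 1/B is at most 1, so a bound over all admissible B passes to those that
-- occur. Nonzero entries allow the product of `zs` to be cancelled.
dense-⊆ : ∀ {a b xs ys} → All NonZero ys → Unique xs → (∀ {x} → x ∈ xs → x ∈ ys) → Dense a b ys → Dense a b xs
dense-⊆ {a} {b} {xs} {ys} ys≢0 xs-unique xs⊆ys (dense ys-bound) with unique-⊆⇒↭-++ xs-unique xs⊆ys
... | zs , ys↭xs++zs = dense (*-cancelʳ-≤ (a * product xs) (b * product (map pred xs)) (product zs) (begin
  a * product xs * product zs                                 ≡⟨ *-assoc a (product xs) (product zs) ⟩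
  a * (product xs * product zs)                               ≡⟨ cong (a *_) product-ys ⟨
  a * product ys                                              ≤⟨ ys-bound ⟩
  b * product (map pred ys)                                   ≡⟨ cong (b *_) (product-↭ (map⁺ pred ys↭xs++zs)) ⟩
  b * product (map pred (xs ++ zs))                           ≡⟨ cong (λ zs → b * product zs) (map-++ pred xs zs) ⟩
  b * product (map pred xs ++ map pred zs)                    ≡⟨ cong (b *_) (product-++ (map pred xs) (map pred zs)) ⟩
  b * (product (map pred xs) * product (map pred zs))         ≤⟨ *-monoʳ-≤ b (*-monoʳ-≤ (product (map pred xs)) (product-pred≤ zs)) ⟩
  b * (product (map pred xs) * product zs)                    ≡⟨ *-assoc b _ (product zs) ⟨
  b * product (map pred xs) * product zs                      ∎))
  where
  open ≤-Reasoning
  product-ys : product ys ≡ product xs * product zs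
  product-ys = trans (product-↭ ys↭xs++zs) (product-++ xs zs)
  instance
    zs≢0 : NonZero (product zs)
    zs≢0 = m*n≢0⇒n≢0 (product xs) {{subst NonZero product-ys (product≢0 ys≢0)}}

-- Each term c of a progression is expanded to a block `F c`. With `[_]` this is a plain
-- progression; with a progression as `F` it is a two-dimensional array.
geometric : (ℕ → List ℕ) → ℕ → ℕ → ℕ → List ℕ
geometric F r c zero = []
geometric F r c (suc k) = F c ++ geometric F r (c * r) k

∈-geometric : ∀ F r c {k j b} → j < k → b ∈ F (c * r ^ j) → b ∈ geometric F r c k
∈-geometric F r c {j = zero} (s≤s _) b∈ = ∈-++⁺ˡ (subst (λ c → _ ∈ F c) (*-identityʳ c) b∈)
∈-geometric F r c {j = suc j} {b} (s≤s j<k) b∈ =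
  ∈-++⁺ʳ (F c) (∈-geometric F r (c * r) j<k (subst (λ c → b ∈ F c) (sym (*-assoc c r (r ^ j))) b∈))

geometric-nonZero : ∀ F r c .{{_ : NonZero r}} .{{_ : NonZero c}} → (∀ c → .{{NonZero c}} → All NonZero (F c)) →
                    ∀ k → All NonZero (geometric F r c k)
geometric-nonZero F r c F≢0 zero = []
geometric-nonZero F r c F≢0 (suc k) = All.++⁺ (F≢0 c) (geometric-nonZero F r (c * r) F≢0 k)
  where instance _ = m*n≢0 c r

-- ∏ (1 - 1/(c rʲ)) ≥ 1 - ∑ 1/(c rʲ) ≥ 1 - r/(c (r - 1)), where r = suc s.
dense-geometric : ∀ F s c → .{{NonZero c}} → (∀ c → .{{NonZero c}} → Dense (pred c) c (F c)) →
                  ∀ k → Dense (s * c ∸ suc s) (s * c) (geometric F (suc s) c k)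
dense-geometric F s c F-dense k = dense (subst (_≤ s * c * product (map pred bs)) (sym (*-distribʳ-∸ (product bs) (s * c) r))
  (m≤n+o⇒m∸n≤o (s * c * product bs) (r * product bs) (subst (s * c * product bs ≤_) (+-comm (s * c * product (map pred bs)) _) (weak c k))))
  where
  open ≤-Reasoning
  r = suc s
  bs = geometric F r c k
  -- The subtracted term stands on the right, which keeps truncated subtraction out of the
  -- induction. The tail from `c * r` contributes at least 1 - 1/(s c), and (1 - 1/c)(1 - 1/(s c)) ≥
  -- 1 - r/(s c).
  weak : ∀ c → .{{NonZero c}} → ∀ k →
         s * c * product (geometric F r c k) ≤ s * c * product (map pred (geometric F r c k)) + r * product (geometric F r c k)
  weak c zero = m≤m+n _ _
  weak c@(suc b) (suc k) = *-cancelˡ-≤ c (begin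
    c * (s * c * product (F c ++ rest))            ≡⟨ cong (λ x → c * (s * c * x)) (product-++ (F c) rest) ⟩
    c * (s * c * (D₁ * D))                         ≡⟨ lemma₁ b s D₁ D ⟩
    b * D₁ * (s * c * D) + s * c * D₁ * D          ≤⟨ +-monoˡ-≤ (s * c * D₁ * D) (*-monoʳ-≤ (b * D₁) ih) ⟩
    b * D₁ * (s * c * M + D) + s * c * D₁ * D      ≡⟨ lemma₂ b s D₁ D M ⟩
    s * c * M * (b * D₁) + (s * c * D₁ * D + b * (D₁ * D))
      ≤⟨ +-mono-≤ (*-monoʳ-≤ (s * c * M) (Dense.bound (F-dense c))) (+-monoʳ-≤ (s * c * D₁ * D) (m≤n+m (b * (D₁ * D)) (D₁ * D))) ⟩
    s * c * M * (c * M₁) + (s * c * D₁ * D + c * (D₁ * D)) ≡⟨ lemma₃ b s D₁ D M₁ M ⟩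
    c * (s * c * (M₁ * M) + r * (D₁ * D))          ≡⟨ cong₂ (λ x y → c * (s * c * x + r * y)) (sym product-pred) (sym (product-++ (F c) rest)) ⟩
    c * (s * c * product (map pred (F c ++ rest)) + r * product (F c ++ rest)) ∎)
    where
    rest = geometric F r (c * r) k
    D₁ = product (F c)
    M₁ = product (map pred (F c))
    D = product rest
    M = product (map pred rest)
    ih : s * c * D ≤ s * c * M + D
    ih = *-cancelˡ-≤ r (subst₂ _≤_ (lemma s c r D) (lemma′ s c r M D) (weak (c * r) k))
      where
      lemma : ∀ s c r D → s * (c * r) * D ≡ r * (s * c * D)
      lemma = solve-∀
      lemma′ : ∀ s c r M D → s * (c * r) * M + r * D ≡ r * (s * c * M + D)
      lemma′ = solve-∀
    product-pred : product (map pred (F c ++ rest)) ≡ M₁ * M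
    product-pred = trans (cong product (map-++ pred (F c) rest)) (product-++ (map pred (F c)) (map pred rest))
    lemma₁ : ∀ b s D₁ D → suc b * (s * suc b * (D₁ * D)) ≡ b * D₁ * (s * suc b * D) + s * suc b * D₁ * D
    lemma₁ = solve-∀
    lemma₂ : ∀ b s D₁ D M → b * D₁ * (s * suc b * M + D) + s * suc b * D₁ * D ≡
                            s * suc b * M * (b * D₁) + (s * suc b * D₁ * D + b * (D₁ * D))
    lemma₂ = solve-∀
    lemma₃ : ∀ b s D₁ D M₁ M → s * suc b * M * (suc b * M₁) + (s * suc b * D₁ * D + suc b * (D₁ * D)) ≡
                               suc b * (s * suc b * (M₁ * M) + suc s * (D₁ * D))
    lemma₃ = solve-∀

[_]-nonZero : ∀ c → .{{NonZero c}} → All NonZero [ c ]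
[ suc c ]-nonZero = _ ∷ []

dense-[_] : ∀ c → .{{NonZero c}} → Dense (pred c) c [ c ]
dense-[ c ] = dense (≤-reflexive (lemma (pred c) c))
  where
  lemma : ∀ b c → b * (c * 1) ≡ c * (b * 1)
  lemma = solve-∀

-- The numbers 2ˣ q^y with 1 ≤ x ≤ X and 1 ≤ y ≤ Y.
grid : (q X Y : ℕ) → List ℕ
grid q X Y = geometric (λ c → geometric [_] 2 (2 * c) X) q q Y

-- The bound is 1 - 1/(q - 1). A row 2c, 4c, 8c, ... has density at least 1 - 2/(2c) = 1 - 1/c,
-- exactly what the progression of the c = q^y asks of a block.
dense-grid : ∀ s X Y → Dense (s * suc s ∸ suc s) (s * suc s) (grid (suc s) X Y)
dense-grid s X Y = dense-geometric (λ c → geometric [_] 2 (2 * c) X) s (suc s) row Y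
  where
  row : ∀ c → .{{NonZero c}} → Dense (pred c) c (geometric [_] 2 (2 * c) X)
  row c@(suc b) = dense (*-cancelˡ-≤ 2 (subst₂ _≤_
    (trans (cong (_* product bs) (lemma b)) (*-assoc 2 b _))
    (lemma′ c (product (map pred bs)))
    (Dense.bound (dense-geometric [_] 1 (2 * c) dense-[_] X))))
    where
    bs = geometric [_] 2 (2 * c) X
    lemma : ∀ b → 1 * (2 * suc b) ∸ 2 ≡ 2 * b
    lemma b = cong (_∸ 2) (twice b)
      where
      twice : ∀ b → 1 * (2 * suc b) ≡ 2 + 2 * b
      twice = solve-∀
    lemma′ : ∀ c x → 1 * (2 * c) * x ≡ 2 * (c * x)
    lemma′ = solve-∀

grid-nonZero : ∀ q .{{_ : NonZero q}} X Y → All NonZero (grid q X Y)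
grid-nonZero q X Y = geometric-nonZero _ q q row Y
  where
  row : ∀ c → .{{NonZero c}} → All NonZero (geometric [_] 2 (2 * c) X)
  row c@(suc _) = geometric-nonZero [_] 2 (2 * c) [_]-nonZero X

∈-grid : ∀ q {x y X Y} → x < X → y < Y → 2 ^ suc x * q ^ suc y ∈ grid q X Y
∈-grid q {x} {y} {X} x<X y<Y = ∈-geometric _ q q y<Y (∈-geometric [_] 2 (2 * (q * q ^ y)) x<X (here (lemma (2 ^ x) (q * q ^ y))))
  where
  lemma : ∀ u v → 2 * u * v ≡ 2 * v * u
  lemma = solve-∀

-- Comparison with (1 + 1/F)(1 + 1/Q)/2

-- Since (1 + 1/F)(1 + 1/Q) decreases in both variables, it suffices to beat its value at the lower
-- bounds `F₀` and `Q₀`. The Boolean test lets concrete inequalities be settled by evaluation.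
excluded-by-size : ∀ {N F Q a b} F₀ Q₀ .{{_ : NonZero F₀}} .{{_ : NonZero Q₀}} → F₀ ≤ F → Q₀ ≤ Q →
                   2 * N ≡ suc F * suc Q → a * (F * Q) ≤ b * N →
                   ¬ T (b * (suc F₀ * suc Q₀) <ᵇ 2 * a * (F₀ * Q₀))
excluded-by-size {N} {F} {Q} {a} {b} F₀ Q₀ F₀≤F Q₀≤Q 2N≡ ratio small = <-irrefl refl (begin-strict
  2 * a * (F₀ * Q₀) * (F * Q)                          ≡⟨ lemma₁ a (F₀ * Q₀) (F * Q) ⟩
  2 * (F₀ * Q₀) * (a * (F * Q))                        ≤⟨ *-monoʳ-≤ (2 * (F₀ * Q₀)) ratio ⟩
  2 * (F₀ * Q₀) * (b * N)                              ≡⟨ lemma₂ (F₀ * Q₀) b N ⟩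
  b * (F₀ * Q₀) * (2 * N)                              ≡⟨ cong (b * (F₀ * Q₀) *_) 2N≡ ⟩
  b * (F₀ * Q₀) * (suc F * suc Q)                      ≡⟨ lemma₃ b F₀ Q₀ (suc F) (suc Q) ⟩
  b * ((F₀ * suc F) * (Q₀ * suc Q))                    ≤⟨ *-monoʳ-≤ b (*-mono-≤ (cross F₀≤F) (cross Q₀≤Q)) ⟩
  b * ((F * suc F₀) * (Q * suc Q₀))                    ≡⟨ lemma₄ b F Q (suc F₀) (suc Q₀) ⟩
  b * (suc F₀ * suc Q₀) * (F * Q)                      <⟨ *-monoˡ-< (F * Q) (<ᵇ⇒< (b * (suc F₀ * suc Q₀)) (2 * a * (F₀ * Q₀)) small) ⟩
  2 * a * (F₀ * Q₀) * (F * Q)                          ∎)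
  where
  open ≤-Reasoning
  instance
    FQ≢0 : NonZero (F * Q)
    FQ≢0 = m*n≢0 F Q {{>-nonZero (<-≤-trans (>-nonZero⁻¹ F₀) F₀≤F)}} {{>-nonZero (<-≤-trans (>-nonZero⁻¹ Q₀) Q₀≤Q)}}
  cross : ∀ {x₀ x} → x₀ ≤ x → x₀ * suc x ≤ x * suc x₀
  cross {x₀} {x} x₀≤x = begin
    x₀ * suc x     ≡⟨ *-suc x₀ x ⟩
    x₀ + x₀ * x    ≤⟨ +-mono-≤ x₀≤x (≤-reflexive (*-comm x₀ x)) ⟩
    x + x * x₀     ≡⟨ *-suc x x₀ ⟨
    x * suc x₀     ∎
  lemma₁ : ∀ a u v → 2 * a * u * v ≡ 2 * u * (a * v)
  lemma₁ = solve-∀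
  lemma₂ : ∀ u b N → 2 * u * (b * N) ≡ b * u * (2 * N)
  lemma₂ = solve-∀
  lemma₃ : ∀ b x y u v → b * (x * y) * (u * v) ≡ b * ((x * u) * (y * v))
  lemma₃ = solve-∀
  lemma₄ : ∀ b x y u v → b * ((x * u) * (y * v)) ≡ b * (u * v) * (x * y)
  lemma₄ = solve-∀

-- Admissible components of N

-- `mersenne` carries the fact that `f₂` is not even, so these values disappear from the list when
-- `f₂` is even.
data Candidate (q f₁ f₂ P : ℕ) : Set where
  mixed    : ∀ {x y} → x < f₁ → y < f₂ → suc P ≡ 2 ^ suc x * q ^ suc y → Candidate q f₁ f₂ P
  three    : 2 ≤ f₁ → suc P ≡ 4 → Candidate q f₁ f₂ P
  mersenne : ∀ {k} → 3 + 2 * k ≤ f₁ → (∀ h → f₂ ≢ 2 * h) → suc P ≡ 2 ^ (3 + 2 * k) → Candidate q f₁ f₂ P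

4∣suc⇒%4≡3 : ∀ n → 4 ∣ suc n → n % 4 ≡ 3
4∣suc⇒%4≡3 n 4∣ = %-pred-≡0 {n} (n∣m⇒m%n≡0 (suc n) 4 4∣)

odd-%4 : ∀ {p} → ¬ 2 ∣ p → p % 4 ≡ 1 ⊎ p % 4 ≡ 3
odd-%4 {p} 2∤p = residue (p % 4) (m%n<n p 4) (λ even → 2∤p (m%n≡0⇒n∣m p 2 (trans (sym (m∣n⇒o%n%m≡o%m 2 4 p (divides 2 refl))) even)))
  where
  residue : ∀ c → c < 4 → ¬ c % 2 ≡ 0 → c ≡ 1 ⊎ c ≡ 3
  residue 0 _ odd = contradiction refl odd
  residue 1 _ _ = inj₁ refl
  residue 2 _ odd = contradiction refl odd
  residue 3 _ _ = inj₂ refl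
  residue (suc (suc (suc (suc c)))) (s≤s (s≤s (s≤s (s≤s ())))) _

-- Writing q as `suc s` makes q - 1, which occurs in all the density bounds, available without
-- subtraction.
module Analysis {N s f₁ f₂ : ℕ} .{{_ : NonZero N}} (2∤N : ¬ 2 ∣ N) (q-prime : Prime (suc s)) (2∤q : ¬ 2 ∣ suc s)
                (1≤f₁ : 1 ≤ f₁) (1≤f₂ : 1 ≤ f₂) (σ*N≡ : σ* N ≡ 2 ^ f₁ * suc s ^ f₂)
                (2N≡ : 2 * N ≡ suc (2 ^ f₁) * suc (suc s ^ f₂)) where

  q = suc s

  open Components (components N)

  square-no-mersenne : ∀ {P} h k → PrimePower P → P ∣ N → f₂ ≡ 2 * h → ¬ suc P ≡ 2 ^ (3 + 2 * k)
  square-no-mersenne {P} h k (primePower {p} p-prime a P≡) P∣N f₂≡2h sucP≡ =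
    [ p∤1+F , subst (λ x → ¬ p ∣ suc x) (sym Q≡s²) (3mod4∤1+square p p%4≡3 (q ^ h)) ]′
      (euclidsLemma (suc F) (suc (q ^ f₂)) p-prime (subst (p ∣_) 2N≡ (∣n⇒∣m*n 2 (∣-trans p∣P P∣N))))
    where
    F = 2 ^ f₁
    x = 3 + 2 * k
    p∣P : p ∣ P
    p∣P = subst (p ∣_) (sym P≡) (m∣m*n (p ^ a))
    2∤p : ¬ 2 ∣ p
    2∤p 2∣p = 2∤N (∣-trans 2∣p (∣-trans p∣P P∣N))
    Q≡s² : q ^ f₂ ≡ q ^ h * q ^ h
    Q≡s² = trans (cong (q ^_) (trans f₂≡2h (cong (h +_) (+-identityʳ h)))) (^-distribˡ-+-* q h h)
    P%4≡3 : P % 4 ≡ 3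
    P%4≡3 = 4∣suc⇒%4≡3 P (divides (2 ^ suc (2 * k)) (trans sucP≡ (lemma (2 ^ suc (2 * k)))))
      where
      lemma : ∀ y → 2 * (2 * y) ≡ y * 4
      lemma = solve-∀
    -- If `p` were 1 modulo 4, so would be its power `P`.
    p%4≡3 : p % 4 ≡ 3
    p%4≡3 with odd-%4 2∤p
    ... | inj₂ ≡3 = ≡3
    ... | inj₁ ≡1 with () ← trans (sym (1mod4-^ {p} ≡1 (suc a))) (trans (cong (_% 4) (sym P≡)) P%4≡3)
    -- Modulo p, F = -1 gives Fˣ = -1 as x is odd, whereas 2ˣ = 1 gives Fˣ = 1.
    p∤1+F : ¬ p ∣ suc F
    p∤1+F p∣1+F = 2∤p (∣-reflexive (sym (prime∣prime⇒≡ p-prime prime[2] (∣m+n∣m⇒∣n p∣R+2 p∣R))))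
      where
      R = pred (F ^ x)
      1+R≡F^x : suc R ≡ F ^ x
      1+R≡F^x = suc-pred (F ^ x) {{m^n≢0 F x {{m^n≢0 2 f₁}}}}
      p∣R : p ∣ R
      p∣R = ∣-trans p∣P (∣pred-^ P f₁ (begin
        suc R            ≡⟨ 1+R≡F^x ⟩
        (2 ^ f₁) ^ x     ≡⟨ ^-*-assoc 2 f₁ x ⟩
        2 ^ (f₁ * x)     ≡⟨ cong (2 ^_) (*-comm f₁ x) ⟩
        2 ^ (x * f₁)     ≡⟨ ^-*-assoc 2 x f₁ ⟨
        (2 ^ x) ^ f₁     ≡⟨ cong (_^ f₁) sucP≡ ⟨
        suc P ^ f₁       ∎))
        where open ≡-Reasoning
      p∣R+2 : p ∣ R + 2
      p∣R+2 = subst (p ∣_) (trans (cong (λ j → suc (F ^ j)) (lemma k)) (trans (cong suc (sym 1+R≡F^x)) (+-comm 2 R)))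
                (∣-trans p∣1+F (suc∣suc-odd^ F (suc k)))
        where
        lemma : ∀ k → suc (2 * suc k) ≡ 3 + 2 * k
        lemma = solve-∀

  candidate : ∀ {P} → P ∈ list → Candidate q f₁ f₂ P
  candidate {P} P∈ with ∣prime^*⇒ prime[2] f₁ (q ^ f₂) (subst (suc P ∣_) (trans product≡σ* σ*N≡) (∈⇒∣product (∈-map⁺ suc P∈)))
  ... | x , d , x≤f₁ , sucP≡ , d∣ with ∣prime^*⇒ {d = d} q-prime f₂ 1 (subst (d ∣_) (sym (*-identityʳ (q ^ f₂))) d∣)
  ... | y , e , y≤f₂ , d≡ , e∣1 = cases x y x≤f₁ y≤f₂ (trans sucP≡ (cong (2 ^ x *_) (trans d≡ (trans (cong (q ^ y *_) (∣1⇒≡1 e∣1)) (*-identityʳ (q ^ y))))))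
    where
    P-pp : PrimePower P
    P-pp = All.lookup powers P∈
    P∣N : P ∣ N
    P∣N = subst (P ∣_) product≡n (∈⇒∣product P∈)
    2∣suc-P : 2 ∣ suc P
    2∣suc-P = odd⇒2∣suc (λ 2∣P → 2∤N (∣-trans 2∣P P∣N))
    mersenne-cases : ∀ x → x ≤ f₁ → suc P ≡ 2 ^ x → x ≡ 2 ⊎ ∃[ k ] x ≡ 3 + 2 * k → Candidate q f₁ f₂ P
    mersenne-cases x x≤f₁ sucP≡ (inj₁ refl) = three x≤f₁ sucP≡
    mersenne-cases x x≤f₁ sucP≡ (inj₂ (k , refl)) =
      mersenne {k = k} x≤f₁ (λ h f₂≡2h → square-no-mersenne h k P-pp P∣N f₂≡2h sucP≡) sucP≡
    cases : ∀ x y → x ≤ f₁ → y ≤ f₂ → suc P ≡ 2 ^ x * q ^ y → Candidate q f₁ f₂ P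
    cases x zero x≤f₁ _ eq = mersenne-cases x x≤f₁ eq′ (mersenne-exponent P-pp x eq′)
      where
      eq′ : suc P ≡ 2 ^ x
      eq′ = trans eq (*-identityʳ (2 ^ x))
    -- A power of q is odd, whereas P + 1 is even because `P` divides the odd N.
    cases zero (suc y) _ _ eq =
      contradiction (prime∣^⇒∣ prime[2] (suc y) (subst (2 ∣_) (trans eq (*-identityˡ (q ^ suc y))) 2∣suc-P)) 2∤q
    cases (suc x) (suc y) x<f₁ y<f₂ eq = mixed x<f₁ y<f₂ eq

  excluded-by-density : ∀ {a b ys} F₀ Q₀ .{{_ : NonZero F₀}} .{{_ : NonZero Q₀}} → F₀ ≤ 2 ^ f₁ → Q₀ ≤ q ^ f₂ →
                        All NonZero ys → Dense a b ys → (∀ {P} → Candidate q f₁ f₂ P → suc P ∈ ys) →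
                        ¬ T (b * (suc F₀ * suc Q₀) <ᵇ 2 * a * (F₀ * Q₀))
  excluded-by-density {a} {b} {ys} F₀ Q₀ F₀≤F Q₀≤Q ys≢0 ys-dense complete =
    excluded-by-size {N} {2 ^ f₁} {q ^ f₂} {a} {b} F₀ Q₀ F₀≤F Q₀≤Q 2N≡ (subst₂ (λ x y → a * x ≤ b * y)
      (trans product≡σ* σ*N≡)
      (trans (cong product (trans (sym (map-∘ list)) (map-id list))) product≡n)
      (Dense.bound (dense-⊆ ys≢0 (Unique.map⁺ suc-injective distinct) sub ys-dense)))
    where
    sub : ∀ {B} → B ∈ map suc list → B ∈ ys
    sub B∈ with ∈-map⁻ suc B∈
    ... | P , P∈ , refl = complete (candidate P∈)

  -- Exclusion of exponents by density

  -- 2a/b > (1 + 1/F₀)(1 + 1/Q₀) without denominators, for F₀ = 2, 4, 8 and a/b the density of the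
  -- candidates for f₁ = 1, for f₁ = 2, and for f₂ even.
  Small₁ Small₂ Small₃ : ℕ → Set
  Small₁ Q₀ = T (s * (2 * q) * (3 * suc Q₀) <ᵇ 2 * (s * (2 * q) ∸ q) * (2 * Q₀))
  Small₂ Q₀ = T (4 * (s * (2 * q) * (s * (4 * q))) * (5 * suc Q₀) <ᵇ 2 * (3 * ((s * (2 * q) ∸ q) * (s * (4 * q) ∸ q))) * (4 * Q₀))
  Small₃ Q₀ = T (4 * (s * q) * (9 * suc Q₀) <ᵇ 2 * (3 * (s * q ∸ q)) * (8 * Q₀))

  geometric₁-nonZero : ∀ c .{{_ : NonZero c}} r .{{_ : NonZero r}} k → All NonZero (geometric [_] r c k)
  geometric₁-nonZero c r = geometric-nonZero [_] r c [_]-nonZero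

  ∈-row : ∀ x {y} → y < f₂ → 2 ^ suc x * q ^ suc y ∈ geometric [_] q (2 ^ suc x * q) f₂
  ∈-row x {y} y<f₂ = ∈-geometric [_] q (2 ^ suc x * q) y<f₂ (here (sym (*-assoc (2 ^ suc x) q (q ^ y))))

  -- Only B = 2q^y remain, with density at least 1 - 1/(2(q - 1)), against a right side of (3/4)(1 +
  -- 1/Q).
  f₁≢1 : ∀ Q₀ .{{_ : NonZero Q₀}} → Q₀ ≤ q ^ f₂ → Small₁ Q₀ → f₁ ≢ 1
  f₁≢1 Q₀ Q₀≤Q small refl = excluded-by-density 2 Q₀ ≤-refl Q₀≤Q
    (geometric₁-nonZero (2 * q) q f₂) (dense-geometric [_] s (2 * q) dense-[_] f₂) complete small
    where
    ys = geometric [_] q (2 * q) f₂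
    complete : ∀ {P} → Candidate q 1 f₂ P → suc P ∈ ys
    complete (mixed {zero} _ y<f₂ eq) = subst (_∈ ys) (sym eq) (∈-row 0 y<f₂)
    complete (mixed {suc x} (s≤s ()) _ _)
    complete (three (s≤s ()) _)
    complete (mersenne (s≤s ()) _ _)

  -- The values are 4, 2q^y and 4q^y, with density at least (3/4)(1 - 1/(2(q - 1)))(1 - 1/(4(q -
  -- 1))), against (5/8)(1 + 1/Q).
  f₁≢2 : ∀ Q₀ .{{_ : NonZero Q₀}} → Q₀ ≤ q ^ f₂ → Small₂ Q₀ → f₁ ≢ 2
  f₁≢2 Q₀ Q₀≤Q small refl = excluded-by-density 4 Q₀ ≤-refl Q₀≤Q
    (_ ∷ All.++⁺ (geometric₁-nonZero (2 * q) q f₂) (geometric₁-nonZero (4 * q) q f₂))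
    (dense-++ [ 4 ] (row₁ ++ row₂) (dense {3} {4} ≤-refl)
      (dense-++ row₁ row₂
        (dense-geometric [_] s (2 * q) dense-[_] f₂) (dense-geometric [_] s (4 * q) dense-[_] f₂)))
    complete small
    where
    row₁ = geometric [_] q (2 * q) f₂
    row₂ = geometric [_] q (4 * q) f₂
    complete : ∀ {P} → Candidate q 2 f₂ P → suc P ∈ 4 ∷ row₁ ++ row₂
    complete (mixed {0} _ y<f₂ eq) = there (∈-++⁺ˡ (subst (_∈ row₁) (sym eq) (∈-row 0 y<f₂)))
    complete (mixed {1} _ y<f₂ eq) = there (∈-++⁺ʳ row₁ (subst (_∈ row₂) (sym eq) (∈-row 1 y<f₂)))
    complete (mixed {suc (suc x)} (s≤s (s≤s ())) _ _)
    complete (three _ eq) = here eq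
    complete (mersenne (s≤s (s≤s ())) _ _)

  f₁≥3 : ∀ Q₀ .{{_ : NonZero Q₀}} → Q₀ ≤ q ^ f₂ → Small₁ Q₀ → Small₂ Q₀ → 3 ≤ f₁
  f₁≥3 Q₀ Q₀≤Q small₁ small₂ =
    ≤∧≢⇒< (≤∧≢⇒< 1≤f₁ (≢-sym (f₁≢1 Q₀ Q₀≤Q small₁))) (≢-sym (f₁≢2 Q₀ Q₀≤Q small₂))

  -- Now Q ≥ q² and F ≥ 8, so the right side is at most (9/16)(1 + 1/q²), while 4 and the grid give
  -- at least (3/4)(1 - 1/(q - 1)).
  f₂≢even : Small₁ (q ^ 2) → Small₂ (q ^ 2) → Small₃ (q ^ 2) → ∀ h → f₂ ≢ 2 * h
  f₂≢even small₁ small₂ small₃ zero f₂≡0 = m<n⇒n≢0 1≤f₂ f₂≡0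
  f₂≢even small₁ small₂ small₃ (suc h) f₂≡2h = excluded-by-density 8 (q ^ 2)
    (^-monoʳ-≤ 2 (f₁≥3 (q ^ 2) Q₀≤Q small₁ small₂)) Q₀≤Q
    (_ ∷ grid-nonZero q f₁ f₂)
    (dense-++ [ 4 ] (grid q f₁ f₂) (dense {3} {4} ≤-refl) (dense-grid s f₁ f₂)) complete small₃
    where
    complete : ∀ {P} → Candidate q f₁ f₂ P → suc P ∈ 4 ∷ grid q f₁ f₂
    complete (mixed x<f₁ y<f₂ eq) = there (subst (_∈ grid q f₁ f₂) (sym eq) (∈-grid q x<f₁ y<f₂))
    complete (three _ eq) = here eq
    complete (mersenne _ odd _) = contradiction f₂≡2h (odd (suc h))
    Q₀≤Q : q ^ 2 ≤ q ^ f₂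
    Q₀≤Q = ^-monoʳ-≤ q (subst (2 ≤_) (sym (trans f₂≡2h (*-suc 2 h))) (s≤s (s≤s z≤n)))

  -- 21/32 = (1 - 1/4)(1 - 1/8), and 92/96 accounts for the 2ˣ with x ≥ 5 odd.
  2^f₁≱ : ∀ F₀ Q₀ .{{_ : NonZero F₀}} .{{_ : NonZero Q₀}} → Q₀ ≤ q ^ f₂ →
          T (32 * (96 * (s * q)) * (suc F₀ * suc Q₀) <ᵇ 2 * (21 * (92 * (s * q ∸ q))) * (F₀ * Q₀)) → ¬ F₀ ≤ 2 ^ f₁
  2^f₁≱ F₀ Q₀ Q₀≤Q small F₀≤F = excluded-by-density F₀ Q₀ F₀≤F Q₀≤Q
    (_ ∷ _ ∷ All.++⁺ (geometric₁-nonZero 32 4 f₁) (grid-nonZero q f₁ f₂))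
    (dense-++ (4 ∷ 8 ∷ []) tail (dense {21} {32} ≤-refl)
      (dense-++ (geometric [_] 4 32 f₁) (grid q f₁ f₂) (dense-geometric [_] 3 32 dense-[_] f₁) (dense-grid s f₁ f₂)))
    complete small
    where
    tail = geometric [_] 4 32 f₁ ++ grid q f₁ f₂
    complete : ∀ {P} → Candidate q f₁ f₂ P → suc P ∈ 4 ∷ 8 ∷ tail
    complete (mixed x<f₁ y<f₂ eq) = there (there (∈-++⁺ʳ (geometric [_] 4 32 f₁) (subst (_∈ grid q f₁ f₂) (sym eq) (∈-grid q x<f₁ y<f₂))))
    complete (three _ eq) = here eq
    complete (mersenne {zero} _ _ eq) = there (here eq)
    complete (mersenne {suc k} 5+2k≤f₁ _ eq) = there (there (∈-++⁺ˡ (subst (_∈ geometric [_] 4 32 f₁) (sym (trans eq eq′))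
      (∈-geometric [_] 4 32 {j = k} k<f₁ (here refl)))))
      where
      -- The progression 32, 128, ... was given `f₁` terms, more than the exponents 5 + 2k ≤ f₁ can
      -- reach.
      k<f₁ : k < f₁
      k<f₁ = ≤-trans (≤-trans (m≤m+n (suc k) (suc k + 0)) (m≤n+m (2 * suc k) 3)) 5+2k≤f₁
      eq′ : 2 ^ (3 + 2 * suc k) ≡ 32 * 4 ^ k
      eq′ = trans (cong (2 ^_) (lemma k)) (trans (^-distribˡ-+-* 2 5 (2 * k)) (cong (32 *_) (sym (^-*-assoc 2 2 k))))
        where
        lemma : ∀ k → 3 + 2 * suc k ≡ 5 + 2 * k
        lemma = solve-∀

  -- For odd `f₂`, 4 divides q + 1, which divides Q + 1 and hence 2N; then N would be even.
  3mod4⇒f₂-even : q % 4 ≡ 3 → ∀ k → f₂ ≢ suc (2 * k)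
  3mod4⇒f₂-even q%4≡3 k refl = 2∤N (*-cancelˡ-∣ 2 (subst (4 ∣_) (sym 2N≡)
    (∣n⇒∣m*n (suc (2 ^ f₁)) (∣-trans 4∣1+q (suc∣suc-odd^ q k)))))
    where
    4∣1+q : 4 ∣ suc q
    4∣1+q = m%n≡0⇒n∣m (suc q) 4 (trans (%-distribˡ-+ 1 q 4) (cong (λ x → (1 + x) % 4) q%4≡3))

-- The primes 7, 11 and 13

σ*-2^*q^ : ∀ {q} → Prime q → ¬ 2 ∣ q → ∀ a b → σ* (2 ^ suc a * q ^ suc b) ≡ suc (2 ^ suc a) * suc (q ^ suc b)
σ*-2^*q^ {q} q-prime 2∤q a b = trans
  (σ*-prime^-* prime[2] {{prime^-nonZero q-prime (suc b)}} (2∤q ∘ prime∣^⇒∣ prime[2] (suc b)) a)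
  (cong (suc (2 ^ suc a) *_) (σ*-prime^ q-prime b))

theorem5p4 : (N : ℕ) → 0 < N → ¬ (2 ∣ N) → σ* (σ* N) ≡ 2 * N → N ≢ 9 → N ≢ 165 →
    (q f₁ f₂ : ℕ) → Prime q → ¬ (2 ∣ q) → f₁ ≥ 1 → f₂ ≥ 1 →
    σ* N ≡ 2 ^ f₁ * q ^ f₂ →
    q ≢ 7 × q ≢ 11 × q ≢ 13
theorem5p4 N 0<N 2∤N σ*σ*N≡ _ _ q f₁@(suc a) f₂@(suc b) q-prime 2∤q 1≤f₁ 1≤f₂ σ*N≡ = q≢7 , q≢11 , q≢13
  where
  instance
    N≢0 : NonZero N
    N≢0 = >-nonZero 0<N
  2N≡ : 2 * N ≡ suc (2 ^ f₁) * suc (q ^ f₂)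
  2N≡ = trans (sym σ*σ*N≡) (trans (cong σ* σ*N≡) (σ*-2^*q^ q-prime 2∤q a b))

  q≢7 : q ≢ 7
  -- As 7 is 3 modulo 4, both parities of `f₂` are excluded. The underscores are numerical
  -- inequalities that evaluate to true.
  q≢7 refl = let h , h-parity = even-or-odd f₂ in
    [ f₂≢even _ _ _ h , 3mod4⇒f₂-even refl h ]′ h-parity
    where open Analysis {N} {6} {f₁} {f₂} 2∤N q-prime 2∤q 1≤f₁ 1≤f₂ σ*N≡ 2N≡

  q≢11 : q ≢ 11
  q≢11 refl = let h , h-parity = even-or-odd f₂ in
    [ f₂≢even _ _ _ h , 3mod4⇒f₂-even refl h ]′ h-parity
    where open Analysis {N} {10} {f₁} {f₂} 2∤N q-prime 2∤q 1≤f₁ 1≤f₂ σ*N≡ 2N≡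

  q≢13 : q ≢ 13
  q≢13 refl = cases (even-or-odd f₂)
    where
    open Analysis {N} {12} {f₁} {f₂} 2∤N q-prime 2∤q 1≤f₁ 1≤f₂ σ*N≡ 2N≡
    3≤f₁ : 3 ≤ f₁
    3≤f₁ = f₁≥3 13 (^-monoʳ-≤ 13 {1} {f₂} (s≤s z≤n)) _ _
    -- Here `b` is f₂ - 1, so Q = 13 in this case.
    2^f₁<16 : b ≡ 0 → ¬ 16 ≤ 2 ^ f₁
    2^f₁<16 refl = 2^f₁≱ 16 13 ≤-refl _
    -- N = 63 is left over, but σ* 63 = 80.
    f₁≢3 : b ≡ 0 → 3 ≢ f₁
    f₁≢3 refl refl = contradiction (trans (cong σ* (sym (*-cancelˡ-≡ N 63 2 2N≡))) σ*N≡) λ ()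
    cases : ¬ (∃[ h ] (f₂ ≡ 2 * h ⊎ f₂ ≡ suc (2 * h)))
    cases (h , inj₁ even) = f₂≢even _ _ _ h even
    -- With f₂ = 1 the density bound works from F = 16 on; F = 8 is treated by `f₁≢3`.
    cases (zero , inj₂ odd) = 2^f₁<16 b≡0 (^-monoʳ-≤ 2 (≤∧≢⇒< 3≤f₁ (f₁≢3 b≡0)))
      where b≡0 = suc-injective odd
    -- With f₂ ≥ 3 the term 1/Q is so small that F ≥ 8 already suffices.
    cases (suc h , inj₂ odd) = 2^f₁≱ 8 (13 ^ 3) (^-monoʳ-≤ 13 3≤f₂) _ (^-monoʳ-≤ 2 3≤f₁)
      where
      3≤f₂ : 3 ≤ f₂
      3≤f₂ = subst (3 ≤_) (sym (trans odd (cong suc (*-suc 2 h)))) (s≤s (s≤s (s≤s z≤n)))
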